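{- There exists a constant $c>0$ such that for all sufficiently large $n$ there is a partial function $f$ on $\{0,1\}^n$ that is minimally non-extendable and whose domain satisfies $|\mathrm{D}(f)| \ge 2^{cn}$ (i.e. $|\mathrm{D}(f)| = 2^{\Omega(n)}$).
   Context: A partial function $f$ on $\{0,1\}^n$ is a real-valued function defined on a subset $\mathrm{D}(f)\subseteq\{0,1\}^n$. A function $g:\{0,1\}^n\to\mathbb{R}$ is submodular if $g(x+\mathbf{e}_i)-g(x) \ge g(y+\mathbf{e}_i)-g(y)$ for all $i$ and all $x\le y$ (coordinatewise) with $x_i=y_i=0$, where $\mathbf{e}_i$ is the $i$-th standard basis vector. A partial function $f$ is extendable if there is a submodular $g:\{0,1\}^n\to\mathbb{R}$ agreeing with $f$ on $\mathrm{D}(f)$. For $\mathcal{A}\subseteq\{0,1\}^n$, $f|_{\mathcal{A}}$ is the partial function agreeing with $f$ on $\mathcal{A}\cap \mathrm{D}(f)$ and undefined elsewhere. $f$ is minimally non-extendable if $f$ is not extendable but $f|_{\mathcal{A}}$ is extendable for every proper subset $\mathcal{A}\subsetneq \mathrm{D}(f)$. -}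

module Defs where

open import Data.Bool.Base using (Bool; true; false; if_then_else_)
import Data.Bool.Base as Bool
open import Data.Fin.Base using (Fin)
open import Data.List.Base as List using (List; length; filter)
open import Data.Maybe using (Maybe; just; nothing; Is-just)
open import Data.Maybe.Relation.Unary.Any using (dec)
open import Data.Nat.Base as ℕ using (ℕ; zero; suc; _⊔_)
import Data.Nat.Properties as ℕ
open import Data.Product.Base using (∃-syntax; _×_; _,_)
open import Data.Rational using (ℚ; 0ℚ; ½; _+_; _*_; _-_; _<_; ∣_∣)
open import Data.Rational.Properties
open import Data.Rational.Solver using (module +-*-Solver)
open import Data.Unit.Base using (tt)
open import Data.Vec.Base using (Vec; []; _∷_; lookup; _[_]≔_)
open import Data.Vec.Relation.Binary.Pointwise.Inductive using (Pointwise)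
open import Level using (0ℓ)
open import Relation.Binary.PropositionalEquality using (_≡_; refl; cong; subst)
open import Relation.Nullary.Decidable using (yes; does)
open import Relation.Nullary.Negation using (¬_)
open import Relation.Unary using (Pred; Decidable; _⊂_)

-- Real numbers: Cauchy sequences of rationals, compared up to null sequences.

Cauchy : (ℕ → ℚ) → Set
Cauchy s = ∀ ε → 0ℚ < ε →
  ∃[ N ] (∀ m n → N ℕ.≤ m → N ℕ.≤ n → ∣ s m - s n ∣ < ε)

record ℝ : Set where
  constructor mkℝ
  field
    seq    : ℕ → ℚ
    cauchy : Cauchy seq

open ℝ public

infix 4 _≃ᴿ_ _≤ᴿ_
infixl 6 _-ᴿ_

_≃ᴿ_ : ℝ → ℝ → Set
x ≃ᴿ y = ∀ ε → 0ℚ < ε → ∃[ N ] (∀ n → N ℕ.≤ n → ∣ seq x n - seq y n ∣ < ε)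

_≤ᴿ_ : ℝ → ℝ → Set
x ≤ᴿ y = ∀ ε → 0ℚ < ε → ∃[ N ] (∀ n → N ℕ.≤ n → seq x n < seq y n + ε)

private
  regroup : ∀ a b c d → (a - b) - (c - d) ≡ (a - c) - (b - d)
  regroup = solve 4 (λ a b c d → (a :- b) :- (c :- d) := (a :- c) :- (b :- d)) refl
    where open +-*-Solver

  half+half : ∀ ε → ½ * ε + ½ * ε ≡ ε
  half+half = solve 1 (λ ε → con ½ :* ε :+ con ½ :* ε := ε) refl
    where open +-*-Solver

  half-positive : ∀ {ε} → 0ℚ < ε → 0ℚ < ½ * ε
  half-positive {ε} 0<ε =
    subst (_< ½ * ε) (*-zeroʳ ½) (*-monoʳ-<-pos ½ 0<ε)

_-ᴿ_ : ℝ → ℝ → ℝ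
seq (x -ᴿ y) n = seq x n - seq y n
cauchy (x -ᴿ y) ε 0<ε
  with cauchy x (½ * ε) (half-positive 0<ε) | cauchy y (½ * ε) (half-positive 0<ε)
... | M , hx | N , hy = M ⊔ N , λ m n M⊔N≤m M⊔N≤n → begin-strict
    ∣ (seq x m - seq y m) - (seq x n - seq y n) ∣
      ≡⟨ cong ∣_∣ (regroup (seq x m) (seq y m) (seq x n) (seq y n)) ⟩
    ∣ (seq x m - seq x n) - (seq y m - seq y n) ∣
      ≤⟨ ∣p-q∣≤∣p∣+∣q∣ (seq x m - seq x n) (seq y m - seq y n) ⟩
    ∣ seq x m - seq x n ∣ + ∣ seq y m - seq y n ∣
      <⟨ +-mono-< (hx m n (ℕ.m⊔n≤o⇒m≤o M N M⊔N≤m) (ℕ.m⊔n≤o⇒m≤o M N M⊔N≤n))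
                  (hy m n (ℕ.m⊔n≤o⇒n≤o M N M⊔N≤m) (ℕ.m⊔n≤o⇒n≤o M N M⊔N≤n)) ⟩
    ½ * ε + ½ * ε
      ≡⟨ half+half ε ⟩
    ε ∎
  where open ≤-Reasoning

Cube : ℕ → Set
Cube n = Vec Bool n

infix 4 _≼_

_≼_ : ∀ {n} → Cube n → Cube n → Set
_≼_ = Pointwise Bool._≤_

-- This is x + eᵢ when xᵢ = 0, the only case in which it is used.
_+e_ : ∀ {n} → Cube n → Fin n → Cube n
x +e i = x [ i ]≔ true

Submodular : ∀ {n} → (Cube n → ℝ) → Set
Submodular g = ∀ i x y → x ≼ y → lookup x i ≡ false → lookup y i ≡ false →
  g (y +e i) -ᴿ g y ≤ᴿ g (x +e i) -ᴿ g x

PartialFunction : ℕ → Set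
PartialFunction n = Cube n → Maybe ℝ

D : ∀ {n} → PartialFunction n → Pred (Cube n) 0ℓ
D f x = Is-just (f x)

D? : ∀ {n} (f : PartialFunction n) → Decidable (D f)
D? f x = dec (λ _ → yes tt) (f x)

vertices : ∀ n → List (Cube n)
vertices zero    = List.[ [] ]
vertices (suc n) = List.map (false ∷_) (vertices n) List.++ List.map (true ∷_) (vertices n)

∣D_∣ : ∀ {n} → PartialFunction n → ℕ
∣D f ∣ = length (filter (D? f) (vertices _))

_Extends_ : ∀ {n} → (Cube n → ℝ) → PartialFunction n → Set
g Extends f = ∀ x r → f x ≡ just r → g x ≃ᴿ r

Extendable : ∀ {n} → PartialFunction n → Set
Extendable f = ∃[ g ] (Submodular g × g Extends f)

restrict : ∀ {n} → PartialFunction n → {A : Pred (Cube n) 0ℓ} → Decidable A → PartialFunction n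
restrict f A? x = if does (A? x) then f x else nothing

-- Subsets of the finite cube are taken decidable so that the restriction of a
-- partial function to one is again a partial function; classically all are.
MinimallyNonExtendable : ∀ {n} → PartialFunction n → Set₁
MinimallyNonExtendable {n} f =
  ¬ Extendable f ×
  (∀ (A : Pred (Cube n) 0ℓ) (A? : Decidable A) → A ⊂ D f → Extendable (restrict f A?))

{-# OPTIONS --safe #-}
module Submission where

-- Let z count the zeros of a vertex. If a certificate on n coordinates forces
-- g(1ⁿ) ≤ α from the values of a submodular g on a set E ("anchors"), put copies
-- of it on the faces 01 and 10 of two new coordinates. The square
--   g(11,1ⁿ) ≤ g(01,1ⁿ) + g(10,1ⁿ) − g(00,1ⁿ)
-- then bounds g at the new top from E×{01} ∪ E×{10} ∪ {(00,1ⁿ)}, so the number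
-- of anchors doubles with every two coordinates. The function with faces
-- g − 4z, g, g, g + 2z is submodular and attains the bound. Since it is slack on
-- every square mixing old and new coordinates, and on the squares of the two new
-- ones away from 1ⁿ, each single anchor can be released by a perturbation of size
-- at most 1 that raises the top by 1. The partial function prescribing the tight
-- values on the anchors, and one more than the bound at the top, is therefore
-- minimally non-extendable.

open import Defs
import Algebra.Properties.CommutativeSemigroup as CommutativeSemigroupProperties
open import Data.Bool.Base using (Bool; true; false; if_then_else_; _∨_; f≤t; b≤b)
open import Data.Empty using (⊥-elim)
open import Data.Fin.Base using (zero; suc)
open import Data.Integer.Base using (∣_∣; +_; -[1+_])
open import Data.List.Base as List using (List; length; filter)
open import Data.List.Properties using (filter-++; length-++)
open import Data.Maybe using (Maybe; just; nothing; Is-just)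
open import Data.Nat.Base using (ℕ; zero; suc; _≤_; _*_; _^_; z≤n; s≤s)
import Data.Nat.Base as ℕ
import Data.Nat.Properties as ℕ
import Data.Nat.Solver as ℕ-Solver
open import Data.Product.Base using (Σ-syntax; ∃-syntax; _×_; _,_; proj₁; proj₂)
open import Data.Rational.Base as ℚ using (ℚ; 0ℚ; 1ℚ; ½; _<_; ↥_; ↧ₙ_; _/_)
import Data.Rational.Properties as ℚ
open import Data.Rational.Solver using (module +-*-Solver)
open import Data.Sum.Base using (_⊎_; inj₁; inj₂)
open import Data.Unit.Base using (tt)
open import Data.Vec.Base using ([]; _∷_; lookup; replicate)
open import Data.Vec.Relation.Binary.Pointwise.Inductive using ([]; _∷_)
open import Function.Base using (_∘_; const)
open import Level using (0ℓ)
open import Relation.Binary.PropositionalEquality using (_≡_; _≢_; refl; sym; trans; cong; cong₂; subst; subst₂)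
open import Relation.Nullary.Decidable using (yes; no; does; True; _×-dec_; ¬?; decidable-stable; toWitness)
open import Relation.Nullary.Negation using (¬_; contradiction)
open import Relation.Unary using (Pred; Decidable; _⊂_)

-- The right side keeps the shape in which the anchor count unfolds over the faces 00, 01, 10, 11,
-- namely `1`, `e`, `e`, `0`, with one more for the top.
double-square : ∀ e → 2 * (2 * (1 ℕ.+ e) ^ 2) ≡ (1 ℕ.+ (1 ℕ.+ e ℕ.+ (e ℕ.+ 0))) ^ 2
double-square = solve 1 (λ e → con 2 :* (con 2 :* (con 1 :+ e) :^ 2)
                            := (con 1 :+ (con 1 :+ e :+ (e :+ con 0))) :^ 2) refl
  where open ℕ-Solver.+-*-Solver

open +-*-Solver using (_:+_; _:*_; _:-_; :-_; _:=_; con; solve)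

-- Linear inequalities over the rationals

p≡p+b-b : ∀ p b → p ≡ (p ℚ.+ b) ℚ.- b
p≡p+b-b = solve 2 (λ p b → p := (p :+ b) :- b) refl

-- Every linear inequality below is a sum a ≤ b of known ones, and the ring
-- solver checks that p + b ≡ q + a.

≤-from-sum : ∀ {a b p q} → a ℚ.≤ b → p ℚ.+ b ≡ q ℚ.+ a → p ℚ.≤ q
≤-from-sum {a} {b} {p} {q} a≤b eq = ℚ.≤-trans
  (ℚ.≤-reflexive (trans (p≡p+b-b p b) (cong (ℚ._- b) eq)))
  (ℚ.≤-trans (ℚ.+-monoˡ-≤ (ℚ.- b) (ℚ.+-monoʳ-≤ q a≤b)) (ℚ.≤-reflexive (sym (p≡p+b-b q b))))

<-from-sum : ∀ {a b p q} → a < b → p ℚ.+ b ≡ q ℚ.+ a → p < q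
<-from-sum {a} {b} {p} {q} a<b eq = ℚ.≤-<-trans
  (ℚ.≤-reflexive (trans (p≡p+b-b p b) (cong (ℚ._- b) eq)))
  (ℚ.<-≤-trans (ℚ.+-monoˡ-< (ℚ.- b) (ℚ.+-monoʳ-< q a<b)) (ℚ.≤-reflexive (sym (p≡p+b-b q b))))

2ℚ 4ℚ -4ℚ -1ℚ : ℚ
2ℚ  = + 2 / 1
4ℚ  = + 4 / 1
-4ℚ = -[1+ 3 ] / 1
-1ℚ = -[1+ 0 ] / 1

≤-by-evaluation : ∀ p q {_ : True (p ℚ.≤? q)} → p ℚ.≤ q
≤-by-evaluation p q {t} = toWitness t

0≤1 : 0ℚ ℚ.≤ 1ℚ
0≤1 = ≤-by-evaluation 0ℚ 1ℚ

0<½ : 0ℚ < ½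
0<½ = toWitness {a? = 0ℚ ℚ.<? ½} tt

-- Vertices, their order and their zeros

top : ∀ n → Cube n
top n = replicate n true

isTop : ∀ {n} → Cube n → Bool
isTop []          = true
isTop (false ∷ x) = false
isTop (true  ∷ x) = isTop x

isTop⇒≡top : ∀ {n} (x : Cube n) → isTop x ≡ true → x ≡ top n
isTop⇒≡top []         eq = refl
isTop⇒≡top (true ∷ x) eq = cong (true ∷_) (isTop⇒≡top x eq)

isTop-top : ∀ n → isTop (top n) ≡ true
isTop-top zero    = refl
isTop-top (suc n) = isTop-top n

zeros : ∀ {n} → Cube n → ℚ
zeros []          = 0ℚ
zeros (false ∷ x) = 1ℚ ℚ.+ zeros x
zeros (true  ∷ x) = zeros x

zeros-top : ∀ n → zeros (top n) ≡ 0ℚ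
zeros-top zero    = refl
zeros-top (suc n) = zeros-top n

zeros-+e : ∀ {n} i (x : Cube n) → lookup x i ≡ false → zeros x ≡ 1ℚ ℚ.+ zeros (x +e i)
zeros-+e zero    (false ∷ x) eq = refl
zeros-+e (suc i) (false ∷ x) eq = cong (1ℚ ℚ.+_) (zeros-+e i x eq)
zeros-+e (suc i) (true  ∷ x) eq = zeros-+e i x eq

≼-refl : ∀ {n} {x : Cube n} → x ≼ x
≼-refl {x = []}    = []
≼-refl {x = _ ∷ _} = b≤b ∷ ≼-refl

≼-+e : ∀ {n} (x : Cube n) i → x ≼ x +e i
≼-+e (false ∷ x) zero    = f≤t ∷ ≼-refl
≼-+e (true  ∷ x) zero    = b≤b ∷ ≼-refl
≼-+e (a ∷ x)     (suc i) = b≤b ∷ ≼-+e x i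

≼-top : ∀ {n} (x : Cube n) → x ≼ top n
≼-top []          = []
≼-top (false ∷ x) = f≤t ∷ ≼-top x
≼-top (true  ∷ x) = b≤b ∷ ≼-top x

-- Every strict comparison loses a whole unit of `zeros`. A multiple of `zeros` therefore absorbs
-- bounded perturbations in all antitonicity proofs below.
≼⇒≡⊎zeros< : ∀ {n} {x y : Cube n} → x ≼ y → x ≡ y ⊎ 1ℚ ℚ.+ zeros y ℚ.≤ zeros x
≼⇒≡⊎zeros< [] = inj₁ refl
≼⇒≡⊎zeros< (_∷_ {x = a} a≤b x≼y) with ≼⇒≡⊎zeros< x≼y
≼⇒≡⊎zeros< (f≤t ∷ x≼y)               | inj₁ refl = inj₂ ℚ.≤-refl
≼⇒≡⊎zeros< (b≤b ∷ x≼y)               | inj₁ refl = inj₁ refl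
≼⇒≡⊎zeros< (b≤b {false} ∷ x≼y)       | inj₂ le   = inj₂ (ℚ.+-monoʳ-≤ 1ℚ le)
≼⇒≡⊎zeros< (b≤b {true} ∷ x≼y)        | inj₂ le   = inj₂ le
≼⇒≡⊎zeros< (_∷_ {xs = x} {ys = y} f≤t x≼y) | inj₂ le = inj₂
  (≤-from-sum (ℚ.+-mono-≤ le 0≤1)
    (solve 2 (λ x y → (con 1ℚ :+ y) :+ (x :+ con 1ℚ)
                   := (con 1ℚ :+ x) :+ ((con 1ℚ :+ y) :+ con 0ℚ)) refl (zeros x) (zeros y)))

-- Submodular functions assembled from faces

glue : ∀ {A : Set} {n} → (Cube n → A) → (Cube n → A) → Cube (suc n) → A
glue g h (false ∷ x) = g x
glue g h (true  ∷ x) = h x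

layers : ∀ {A : Set} {n} → (a b c d : Cube n → A) → Cube (suc (suc n)) → A
layers a b c d = glue (glue a b) (glue c d)

Submodularℚ : ∀ {n} → (Cube n → ℚ) → Set
Submodularℚ g = ∀ i x y → x ≼ y → lookup x i ≡ false → lookup y i ≡ false →
  g (y +e i) ℚ.- g y ℚ.≤ g (x +e i) ℚ.- g x

Antitone : ∀ {n} → (Cube n → ℚ) → Set
Antitone h = ∀ {x y} → x ≼ y → h y ℚ.≤ h x

glue-submodular : ∀ {n} {g h : Cube n → ℚ} → Submodularℚ g → Submodularℚ h →
  Antitone (λ x → h x ℚ.- g x) → Submodularℚ (glue g h)
glue-submodular g-sub h-sub anti zero (false ∷ x) (false ∷ y) (_ ∷ x≼y) _ _ = anti x≼y
glue-submodular g-sub h-sub anti (suc i) (false ∷ x) (false ∷ y) (_ ∷ x≼y) = g-sub i x y x≼y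
glue-submodular g-sub h-sub anti (suc i) (true  ∷ x) (true  ∷ y) (_ ∷ x≼y) = h-sub i x y x≼y
glue-submodular g-sub h-sub anti (suc i) (true ∷ x) (false ∷ y) (() ∷ _)
glue-submodular {g = g} {h} g-sub h-sub anti (suc i) (false ∷ x) (true ∷ y) (_ ∷ x≼y) xᵢ yᵢ =
  -- With `x` in the lower face and `y` in the upper one, first go down from `y` to `x` within the
  -- upper face, then drop to the lower face at `x`; the drop is antitonicity along `x ≼ x +e i`.
  ℚ.≤-trans (h-sub i x y x≼y xᵢ yᵢ)
    (≤-from-sum (anti (≼-+e x i))
      (solve 4 (λ h⁺ h g⁺ g → (h⁺ :- h) :+ (h :- g) := (g⁺ :- g) :+ (h⁺ :- g⁺)) refl
        (h (x +e i)) (h x) (g (x +e i)) (g x)))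

layers-submodular : ∀ {n} {a b c d : Cube n → ℚ} →
  Submodularℚ a → Submodularℚ b → Submodularℚ c → Submodularℚ d →
  Antitone (λ x → b x ℚ.- a x) → Antitone (λ x → d x ℚ.- c x) →
  Antitone (λ x → c x ℚ.- a x) → Antitone (λ x → d x ℚ.- b x) →
  (∀ x → d x ℚ.- b x ℚ.≤ c x ℚ.- a x) →
  Submodularℚ (layers a b c d)
layers-submodular {a = a} {b} {c} {d} a-sub b-sub c-sub d-sub ab cd ac bd square =
  glue-submodular (glue-submodular a-sub b-sub ab) (glue-submodular c-sub d-sub cd) anti
  where
  anti : Antitone (λ x → glue c d x ℚ.- glue a b x)
  anti {false ∷ x} {false ∷ y} (_ ∷ x≼y) = ac x≼y
  -- Both the old coordinates and the second new one move: the old ones move first, inside the faces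
  -- `b` and `d`, and the square at `x` does the rest.
  anti {false ∷ x} {true  ∷ y} (_ ∷ x≼y) = ℚ.≤-trans (bd x≼y) (square x)
  anti {true  ∷ x} {true  ∷ y} (_ ∷ x≼y) = bd x≼y
  anti {true  ∷ x} {false ∷ y} (() ∷ _)

-- Tilts and perturbations of size at most 1

tilt : ∀ {n} → ℚ → ℚ → (Cube n → ℚ) → Cube n → ℚ
tilt k s g x = g x ℚ.+ (k ℚ.* zeros x ℚ.+ s)

-- `zeros` is modular: each of its increments is -1, so the tilt shifts both sides by the same
-- amount.
tilt-submodular : ∀ {n} k s (g : Cube n → ℚ) → Submodularℚ g → Submodularℚ (tilt k s g)
tilt-submodular k s g g-sub i x y x≼y xᵢ yᵢ
  rewrite zeros-+e i x xᵢ | zeros-+e i y yᵢ =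
  ≤-from-sum (g-sub i x y x≼y xᵢ yᵢ)
    (solve 8 (λ k s y⁺ y x⁺ x u v →
        (y⁺ :+ (k :* v :+ s)) :- (y :+ (k :* (con 1ℚ :+ v) :+ s)) :+ (x⁺ :- x)
     := (x⁺ :+ (k :* u :+ s)) :- (x :+ (k :* (con 1ℚ :+ u) :+ s)) :+ (y⁺ :- y)) refl
      k s (g (y +e i)) (g y) (g (x +e i)) (g x) (zeros (x +e i)) (zeros (y +e i)))

Near : ∀ {n} → (Cube n → ℚ) → (Cube n → ℚ) → Set
Near g b = ∀ x → b x ℚ.≤ g x ℚ.+ 1ℚ × g x ℚ.≤ b x ℚ.+ 1ℚ

near-refl : ∀ {n} (g : Cube n → ℚ) → Near g g
near-refl g x = x≤x+1 , x≤x+1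
  where
  x≤x+1 : g x ℚ.≤ g x ℚ.+ 1ℚ
  x≤x+1 = ≤-from-sum 0≤1 (sym (ℚ.+-identityʳ _))

-- The difference is `b - g + 4 zeros - s`. On a strict step `b - g` grows by at most 2 while
-- `4 zeros` falls by at least 4; the two copies of `0≤1` discard the surplus.
near-antitone-lower : ∀ {n} {g b : Cube n → ℚ} s → Near g b →
  Antitone (λ x → b x ℚ.- tilt -4ℚ s g x)
near-antitone-lower {g = g} {b} s near {x} {y} x≼y with ≼⇒≡⊎zeros< x≼y
... | inj₁ refl = ℚ.≤-refl
... | inj₂ lt   = ≤-from-sum
  (ℚ.+-mono-≤ (ℚ.+-mono-≤ (proj₁ (near y)) (proj₂ (near x)))
    (ℚ.+-mono-≤ (ℚ.*-monoˡ-≤-nonNeg 4ℚ lt) (ℚ.+-mono-≤ 0≤1 0≤1)))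
  (solve 7 (λ s gx gy bx by u v →
      (by :- (gy :+ (con -4ℚ :* v :+ s)))
        :+ (((gy :+ con 1ℚ) :+ (bx :+ con 1ℚ)) :+ (con 4ℚ :* u :+ (con 1ℚ :+ con 1ℚ)))
   := (bx :- (gx :+ (con -4ℚ :* u :+ s)))
        :+ ((by :+ gx) :+ (con 4ℚ :* (con 1ℚ :+ v) :+ (con 0ℚ :+ con 0ℚ)))) refl
    s (g x) (g y) (b x) (b y) (zeros x) (zeros y))

-- Here the slope 2 is used up exactly: `g - b` may grow by 2, and `2 zeros` falls by at least 2.
near-antitone-upper : ∀ {n} {g b : Cube n → ℚ} t → Near g b →
  Antitone (λ x → tilt 2ℚ t g x ℚ.- b x)
near-antitone-upper {g = g} {b} t near {x} {y} x≼y with ≼⇒≡⊎zeros< x≼y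
... | inj₁ refl = ℚ.≤-refl
... | inj₂ lt   = ≤-from-sum
  (ℚ.+-mono-≤ (ℚ.+-mono-≤ (proj₂ (near y)) (proj₁ (near x))) (ℚ.*-monoˡ-≤-nonNeg 2ℚ lt))
  (solve 7 (λ t gx gy bx by u v →
      ((gy :+ (con 2ℚ :* v :+ t)) :- by)
        :+ (((by :+ con 1ℚ) :+ (gx :+ con 1ℚ)) :+ con 2ℚ :* u)
   := ((gx :+ (con 2ℚ :* u :+ t)) :- bx)
        :+ ((gy :+ bx) :+ con 2ℚ :* (con 1ℚ :+ v))) refl
    t (g x) (g y) (b x) (b y) (zeros x) (zeros y))

-- `Near` settles the four conditions between adjacent faces. Only the square of the two new
-- coordinates remains, to which the tilts contribute `4 zeros - 2 zeros`.
step-submodular : ∀ {n} {g b c : Cube n → ℚ} s t →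
  Submodularℚ g → Submodularℚ b → Submodularℚ c → Near g b → Near g c →
  (∀ x → (s ℚ.+ t) ℚ.+ (g x ℚ.+ g x) ℚ.≤ (b x ℚ.+ c x) ℚ.+ 2ℚ ℚ.* zeros x) →
  Submodularℚ (layers (tilt -4ℚ s g) b c (tilt 2ℚ t g))
step-submodular {g = g} {b} {c} s t g-sub b-sub c-sub gb gc square = layers-submodular
  (tilt-submodular -4ℚ s g g-sub) b-sub c-sub (tilt-submodular 2ℚ t g g-sub)
  (near-antitone-lower s gb) (near-antitone-upper t gc)
  (near-antitone-lower s gc) (near-antitone-upper t gb)
  λ x → ≤-from-sum (square x)
    (solve 6 (λ s t g b c u →
        ((g :+ (con 2ℚ :* u :+ t)) :- b) :+ ((b :+ c) :+ con 2ℚ :* u)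
     := (c :- (g :+ (con -4ℚ :* u :+ s))) :+ ((s :+ t) :+ (g :+ g))) refl
      s t (g x) (b x) (c x) (zeros x))

-- Anchors, tight values and their releases

-- The first two coordinates of a vertex are the new ones.
anchored : ∀ n → Cube n → Bool
anchored zero          = isTop
anchored (suc zero)    = isTop
anchored (suc (suc n)) = layers isTop (anchored n) (anchored n) (const false)

-- Slope 2 on face 11 pays for perturbations of the middle faces; slope -4 on face 00 leaves a
-- further `2 zeros` of slack in the new square, which vanishes only at the top.
price : ∀ n → Cube n → ℚ
price zero          = const 0ℚ
price (suc zero)    = const 0ℚ
price (suc (suc n)) = layers (tilt -4ℚ 0ℚ (price n)) (price n) (price n) (tilt 2ℚ 0ℚ (price n))

-- relax n y releases the anchor y; its value at a vertex y that is not an anchor is junk.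
relax : ∀ n → Cube n → Cube n → ℚ
relax zero       y = const 1ℚ
relax (suc zero) y = const 1ℚ
relax (suc (suc n)) (false ∷ false ∷ y) =
  layers (tilt -4ℚ -1ℚ (price n)) (price n) (price n) (tilt 2ℚ 1ℚ (price n))
relax (suc (suc n)) (false ∷ true ∷ y) =
  layers (tilt -4ℚ 0ℚ (price n)) (relax n y) (price n) (tilt 2ℚ 1ℚ (price n))
relax (suc (suc n)) (true ∷ false ∷ y) =
  layers (tilt -4ℚ 0ℚ (price n)) (price n) (relax n y) (tilt 2ℚ 1ℚ (price n))
relax (suc (suc n)) (true ∷ true ∷ y) = price (suc (suc n))
const-submodular : ∀ {n} c → Submodularℚ {n} (const c)
const-submodular c i x y _ _ _ = ℚ.≤-refl

zeros-nonneg : ∀ {n} (x : Cube n) → 0ℚ ℚ.≤ zeros x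
zeros-nonneg []          = ℚ.≤-refl
zeros-nonneg (false ∷ x) = ℚ.+-mono-≤ 0≤1 (zeros-nonneg x)
zeros-nonneg (true  ∷ x) = zeros-nonneg x

square-flat : ∀ {n} (g : Cube n → ℚ) x → 0ℚ ℚ.+ (g x ℚ.+ g x) ℚ.≤ (g x ℚ.+ g x) ℚ.+ 2ℚ ℚ.* zeros x
square-flat g x = ≤-from-sum (ℚ.*-monoˡ-≤-nonNeg 2ℚ (zeros-nonneg x))
  (solve 2 (λ g u → (con 0ℚ :+ (g :+ g)) :+ con 2ℚ :* u := ((g :+ g) :+ con 2ℚ :* u) :+ con 2ℚ :* con 0ℚ)
    refl (g x) (zeros x))

-- At the top the 1 on the left is matched by the rise of `b`. Elsewhere `2 zeros` is at least 2,
-- which covers that 1 and a drop of `b` by 1.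
square-bumped : ∀ {n} (g b : Cube n → ℚ) → Near g b → b (top n) ≡ g (top n) ℚ.+ 1ℚ →
  ∀ x → 1ℚ ℚ.+ (g x ℚ.+ g x) ℚ.≤ (b x ℚ.+ g x) ℚ.+ 2ℚ ℚ.* zeros x
square-bumped {n} g b near b-top x with ≼⇒≡⊎zeros< (≼-top x)
... | inj₁ refl rewrite b-top | zeros-top n = ℚ.≤-reflexive
  (solve 1 (λ g → con 1ℚ :+ (g :+ g) := ((g :+ con 1ℚ) :+ g) :+ con 2ℚ :* con 0ℚ) refl (g (top n)))
... | inj₂ lt rewrite zeros-top n = ≤-from-sum
  (ℚ.+-mono-≤ (proj₂ (near x)) (ℚ.*-monoˡ-≤-nonNeg 2ℚ lt))
  (solve 3 (λ g b u →
      (con 1ℚ :+ (g :+ g)) :+ ((b :+ con 1ℚ) :+ con 2ℚ :* u)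
   := ((b :+ g) :+ con 2ℚ :* u) :+ (g :+ con 2ℚ :* (con 1ℚ :+ con 0ℚ))) refl
    (g x) (b x) (zeros x))

price-submodular : ∀ n → Submodularℚ (price n)
price-submodular zero          = const-submodular 0ℚ
price-submodular (suc zero)    = const-submodular 0ℚ
price-submodular (suc (suc n)) = step-submodular 0ℚ 0ℚ g-sub g-sub g-sub (near-refl g) (near-refl g)
  (square-flat g)
  where
  g     = price n
  g-sub = price-submodular n

near-layers : ∀ {n} {a b c d a′ b′ c′ d′ : Cube n → ℚ} →
  Near a a′ → Near b b′ → Near c c′ → Near d d′ → Near (layers a b c d) (layers a′ b′ c′ d′)
near-layers a b c d (false ∷ false ∷ x) = a x
near-layers a b c d (false ∷ true  ∷ x) = b x
near-layers a b c d (true  ∷ false ∷ x) = c x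
near-layers a b c d (true  ∷ true  ∷ x) = d x

near-tilt : ∀ {n} k s t (g : Cube n → ℚ) → s ℚ.≤ t ℚ.+ 1ℚ → t ℚ.≤ s ℚ.+ 1ℚ → Near (tilt k s g) (tilt k t g)
near-tilt k s t g s≤t+1 t≤s+1 x = shift s t t≤s+1 , shift t s s≤t+1
  where
  shift : ∀ s t → t ℚ.≤ s ℚ.+ 1ℚ → tilt k t g x ℚ.≤ tilt k s g x ℚ.+ 1ℚ
  shift s t le = ≤-from-sum le
    (solve 4 (λ g l s t → (g :+ (l :+ t)) :+ (s :+ con 1ℚ) := ((g :+ (l :+ s)) :+ con 1ℚ) :+ t) refl
      (g x) (k ℚ.* zeros x) s t)

relax-near : ∀ n y → Near (price n) (relax n y)
relax-near zero       y x = ≤-by-evaluation 1ℚ 1ℚ , ≤-by-evaluation 0ℚ 2ℚ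
relax-near (suc zero) y x = ≤-by-evaluation 1ℚ 1ℚ , ≤-by-evaluation 0ℚ 2ℚ
relax-near (suc (suc n)) (a ∷ b ∷ y) = go a b
  where
  g = price n
  same = near-refl g
  floor = near-refl (tilt -4ℚ 0ℚ g)
  raised = near-tilt 2ℚ 0ℚ 1ℚ g (≤-by-evaluation 0ℚ 2ℚ) (≤-by-evaluation 1ℚ 1ℚ)
  lowered = near-tilt -4ℚ 0ℚ -1ℚ g (≤-by-evaluation 0ℚ 0ℚ) (≤-by-evaluation -1ℚ 1ℚ)

  go : ∀ a b → Near (price (suc (suc n))) (relax (suc (suc n)) (a ∷ b ∷ y))
  go false false = near-layers lowered same same raised
  go false true  = near-layers floor (relax-near n y) same raised
  go true  false = near-layers floor same (relax-near n y) raised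
  go true  true  = near-refl (price (suc (suc n)))

relax-top : ∀ n y → anchored n y ≡ true → relax n y (top n) ≡ price n (top n) ℚ.+ 1ℚ
relax-top zero       y _ = refl
relax-top (suc zero) y _ = refl
relax-top (suc (suc n)) (a ∷ b ∷ y) = go a b
  where
  raised : tilt 2ℚ 1ℚ (price n) (top n) ≡ tilt 2ℚ 0ℚ (price n) (top n) ℚ.+ 1ℚ
  raised = solve 2 (λ g l → g :+ (l :+ con 1ℚ) := (g :+ (l :+ con 0ℚ)) :+ con 1ℚ) refl
    (price n (top n)) (2ℚ ℚ.* zeros (top n))

  go : ∀ a b → anchored (suc (suc n)) (a ∷ b ∷ y) ≡ true →
    relax (suc (suc n)) (a ∷ b ∷ y) (true ∷ true ∷ top n) ≡ tilt 2ℚ 0ℚ (price n) (top n) ℚ.+ 1ℚ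
  go false false _ = raised
  go false true  _ = raised
  go true  false _ = raised

-- On face 00 the shifts -1 and 1 cancel in the square. On faces 01 and 10 the raised face 11 is
-- paid for by the unit that the recursive release gains at the top of its own face.
relax-submodular : ∀ n y → anchored n y ≡ true → Submodularℚ (relax n y)
relax-submodular zero       y _ = const-submodular 1ℚ
relax-submodular (suc zero) y _ = const-submodular 1ℚ
relax-submodular (suc (suc n)) (false ∷ false ∷ y) _ = step-submodular -1ℚ 1ℚ g-sub g-sub g-sub
  (near-refl g) (near-refl g) (square-flat g)
  where
  g     = price n
  g-sub = price-submodular n
relax-submodular (suc (suc n)) (false ∷ true ∷ y) y∈ = step-submodular 0ℚ 1ℚ
  (price-submodular n) (relax-submodular n y y∈) (price-submodular n) (relax-near n y) (near-refl (price n))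
  (square-bumped (price n) (relax n y) (relax-near n y) (relax-top n y y∈))
relax-submodular (suc (suc n)) (true ∷ false ∷ y) y∈ = step-submodular 0ℚ 1ℚ
  (price-submodular n) (price-submodular n) (relax-submodular n y y∈) (near-refl (price n)) (relax-near n y)
  λ x → subst (λ s → _ ℚ.≤ s ℚ.+ 2ℚ ℚ.* zeros x) (ℚ.+-comm (relax n y x) (price n x))
    (square-bumped (price n) (relax n y) (relax-near n y) (relax-top n y y∈) x)

-- Face 00 holds a single anchor, so it can be shifted as a whole; face 11 holds none, so raising it
-- disturbs no anchor. Of the middle faces only the one containing `y` changes, and there the
-- induction applies.
relax-agrees : ∀ n x y → anchored n x ≡ true → anchored n y ≡ true → x ≢ y → relax n y x ≡ price n x
relax-agrees zero [] [] _ _ x≢y = contradiction refl x≢y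
relax-agrees (suc zero) x y x∈ y∈ x≢y =
  contradiction (trans (isTop⇒≡top x x∈) (sym (isTop⇒≡top y y∈))) x≢y
relax-agrees (suc (suc n)) (false ∷ false ∷ x) (false ∷ false ∷ y) x∈ y∈ x≢y =
  contradiction (cong (λ z → false ∷ false ∷ z) (trans (isTop⇒≡top x x∈) (sym (isTop⇒≡top y y∈)))) x≢y
relax-agrees (suc (suc n)) (false ∷ false ∷ x) (false ∷ true  ∷ y) x∈ y∈ x≢y = refl
relax-agrees (suc (suc n)) (false ∷ false ∷ x) (true  ∷ false ∷ y) x∈ y∈ x≢y = refl
relax-agrees (suc (suc n)) (false ∷ true  ∷ x) (false ∷ false ∷ y) x∈ y∈ x≢y = refl
relax-agrees (suc (suc n)) (false ∷ true  ∷ x) (false ∷ true  ∷ y) x∈ y∈ x≢y =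
  relax-agrees n x y x∈ y∈ (x≢y ∘ cong (λ z → false ∷ true ∷ z))
relax-agrees (suc (suc n)) (false ∷ true  ∷ x) (true  ∷ false ∷ y) x∈ y∈ x≢y = refl
relax-agrees (suc (suc n)) (true  ∷ false ∷ x) (false ∷ false ∷ y) x∈ y∈ x≢y = refl
relax-agrees (suc (suc n)) (true  ∷ false ∷ x) (false ∷ true  ∷ y) x∈ y∈ x≢y = refl
relax-agrees (suc (suc n)) (true  ∷ false ∷ x) (true  ∷ false ∷ y) x∈ y∈ x≢y =
  relax-agrees n x y x∈ y∈ (x≢y ∘ cong (λ z → true ∷ false ∷ z))

-- Rational constants among the Cauchy reals

∣p-p∣<ε : ∀ p {ε} → 0ℚ < ε → ℚ.∣ p ℚ.- p ∣ < ε
∣p-p∣<ε p {ε} 0<ε = subst (_< ε) (sym (cong ℚ.∣_∣ (ℚ.+-inverseʳ p))) 0<ε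

ι : ℚ → ℝ
ι q = mkℝ (const q) (λ ε 0<ε → 0 , λ _ _ _ _ → ∣p-p∣<ε q 0<ε)

ι-cong : ∀ {p q} → p ≡ q → ι p ≃ᴿ ι q
ι-cong {p} refl ε 0<ε = 0 , λ _ _ → ∣p-p∣<ε p 0<ε

p≤∣p∣ : ∀ p → p ℚ.≤ ℚ.∣ p ∣
p≤∣p∣ p with ℚ.≤-total 0ℚ p
... | inj₁ 0≤p = ℚ.≤-reflexive (sym (ℚ.0≤p⇒∣p∣≡p 0≤p))
... | inj₂ p≤0 = ℚ.≤-trans p≤0 (ℚ.0≤∣p∣ p)

-p≤∣p∣ : ∀ p → ℚ.- p ℚ.≤ ℚ.∣ p ∣
-p≤∣p∣ p = subst (ℚ.- p ℚ.≤_) (ℚ.∣-p∣≡∣p∣ p) (p≤∣p∣ (ℚ.- p))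

≃⇒≤ : ∀ x y → x ≃ᴿ y → x ≤ᴿ y
≃⇒≤ x y x≃y ε 0<ε with x≃y ε 0<ε
... | N , close = N , λ n N≤n → <-from-sum (ℚ.≤-<-trans (p≤∣p∣ _) (close n N≤n))
  (solve 3 (λ x y ε → x :+ ε := (y :+ ε) :+ (x :- y)) refl (seq x n) (seq y n) ε)

≃⇒≥ : ∀ x y → x ≃ᴿ y → y ≤ᴿ x
≃⇒≥ x y x≃y ε 0<ε with x≃y ε 0<ε
... | N , close = N , λ n N≤n → <-from-sum (ℚ.≤-<-trans (-p≤∣p∣ _) (close n N≤n))
  (solve 3 (λ x y ε → y :+ ε := (x :+ ε) :+ (:- (x :- y))) refl (seq x n) (seq y n) ε)

≤ᴿ-square : ∀ a b c d p q r → a -ᴿ b ≤ᴿ c -ᴿ d → b ≤ᴿ ι p → c ≤ᴿ ι q → ι r ≤ᴿ d →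
  a ≤ᴿ ι ((p ℚ.+ q) ℚ.- r)
≤ᴿ-square a b c d p q r a-b≤c-d b≤p c≤q r≤d ε 0<ε
  with a-b≤c-d ε/4 0<ε/4 | b≤p ε/4 0<ε/4 | c≤q ε/4 0<ε/4 | r≤d ε/4 0<ε/4
  where
  -- One quarter of the error for each of the four hypotheses that are added up.
  ε/4 = + 1 / 4 ℚ.* ε
  0<ε/4 : 0ℚ < ε/4
  0<ε/4 = subst (_< ε/4) (ℚ.*-zeroʳ (+ 1 / 4)) (ℚ.*-monoʳ-<-pos (+ 1 / 4) 0<ε)
... | K , ineq | L , bp | M , cq | N , rd = K ℕ.⊔ L ℕ.⊔ M ℕ.⊔ N , λ n le →
  let K⊔L⊔M≤n = ℕ.m⊔n≤o⇒m≤o (K ℕ.⊔ L ℕ.⊔ M) N le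
      K⊔L≤n   = ℕ.m⊔n≤o⇒m≤o (K ℕ.⊔ L) M K⊔L⊔M≤n
  in <-from-sum
    (ℚ.+-mono-< (ℚ.+-mono-< (ineq n (ℕ.m⊔n≤o⇒m≤o K L K⊔L≤n)) (bp n (ℕ.m⊔n≤o⇒n≤o K L K⊔L≤n)))
                (ℚ.+-mono-< (cq n (ℕ.m⊔n≤o⇒n≤o (K ℕ.⊔ L) M K⊔L⊔M≤n))
                            (rd n (ℕ.m⊔n≤o⇒n≤o (K ℕ.⊔ L ℕ.⊔ M) N le))))
    (solve 8 (λ a b c d p q r ε → let ε/4 = con (+ 1 / 4) :* ε in
        a :+ ((((c :- d) :+ ε/4) :+ (p :+ ε/4)) :+ ((q :+ ε/4) :+ (d :+ ε/4)))
     := (((p :+ q) :- r) :+ ε) :+ (((a :- b) :+ b) :+ (c :+ r))) refl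
      (seq a n) (seq b n) (seq c n) (seq d n) p q r ε)

ι-gap : ∀ x p → x ≤ᴿ ι p → ¬ (ι (p ℚ.+ 1ℚ) ≤ᴿ x)
-- Two strict errors of ½ cannot bridge a gap of 1.
ι-gap x p x≤p p+1≤x with x≤p ½ 0<½ | p+1≤x ½ 0<½
... | M , upper | N , lower = ℚ.<-irrefl refl (<-from-sum {p = 0ℚ} {q = 0ℚ}
  (ℚ.+-mono-< (upper (M ℕ.⊔ N) (ℕ.m≤m⊔n M N)) (lower (M ℕ.⊔ N) (ℕ.m≤n⊔m M N)))
  (solve 2 (λ x p → con 0ℚ :+ ((p :+ con ½) :+ (x :+ con ½)) := con 0ℚ :+ (x :+ (p :+ con 1ℚ))) refl
    (seq x (M ℕ.⊔ N)) p))

ι-submodular : ∀ {n} (g : Cube n → ℚ) → Submodularℚ g → Submodular (ι ∘ g)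
ι-submodular g g-sub i x y x≼y xᵢ yᵢ ε 0<ε = 0 , λ _ _ → <-from-sum
  (ℚ.+-mono-≤-< (g-sub i x y x≼y xᵢ yᵢ) 0<ε)
  (solve 3 (λ p q ε → p :+ (q :+ ε) := (q :+ ε) :+ (p :+ con 0ℚ)) refl
    (g (y +e i) ℚ.- g y) (g (x +e i) ℚ.- g x) ε)

-- The bound that the anchors force

slice-submodular : ∀ {n} (G : Cube (suc n) → ℝ) a → Submodular G → Submodular (λ x → G (a ∷ x))
slice-submodular G a G-sub i x y x≼y = G-sub (suc i) (a ∷ x) (a ∷ y) (b≤b ∷ x≼y)

anchors-bound-top : ∀ n (G : Cube n → ℝ) → Submodular G →
  (∀ x → anchored n x ≡ true → G x ≃ᴿ ι (price n x)) → G (top n) ≤ᴿ ι (price n (top n))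
anchors-bound-top zero       G G-sub agree = ≃⇒≤ (G []) (ι 0ℚ) (agree [] refl)
anchors-bound-top (suc zero) G G-sub agree = ≃⇒≤ (G (true ∷ [])) (ι 0ℚ) (agree (true ∷ []) refl)
anchors-bound-top (suc (suc n)) G G-sub agree =
  subst (λ q → G (true ∷ true ∷ top n) ≤ᴿ ι q) top-price
    (≤ᴿ-square (G (true ∷ true ∷ top n)) (G (false ∷ true ∷ top n))
               (G (true ∷ false ∷ top n)) (G (false ∷ false ∷ top n)) g g (tilt -4ℚ 0ℚ (price n) (top n))
      -- Flipping the first new coordinate gains no more from 01 than from 00.
      (G-sub zero (false ∷ false ∷ top n) (false ∷ true ∷ top n) (b≤b ∷ f≤t ∷ ≼-refl) refl refl)
      (anchors-bound-top n (λ x → G (false ∷ true ∷ x))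
        (slice-submodular (λ x → G (false ∷ x)) true (slice-submodular G false G-sub))
        (λ x → agree (false ∷ true ∷ x)))
      (anchors-bound-top n (λ x → G (true ∷ false ∷ x))
        (slice-submodular (λ x → G (true ∷ x)) false (slice-submodular G true G-sub))
        (λ x → agree (true ∷ false ∷ x)))
      (≃⇒≥ (G (false ∷ false ∷ top n)) (ι (tilt -4ℚ 0ℚ (price n) (top n)))
        (agree (false ∷ false ∷ top n) (isTop-top n))))
  where
  g = price n (top n)
  top-price : (g ℚ.+ g) ℚ.- tilt -4ℚ 0ℚ (price n) (top n) ≡ tilt 2ℚ 0ℚ (price n) (top n)
  -- Both tilts vanish at the top, so the bound `g + g - g` equals the prescribed value there.
  top-price rewrite zeros-top n = solve 1 (λ g →
       (g :+ g) :- (g :+ (con -4ℚ :* con 0ℚ :+ con 0ℚ))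
    := g :+ (con 2ℚ :* con 0ℚ :+ con 0ℚ)) refl g

-- The minimally non-extendable function

-- The anchor test comes first, so the raised value occurs only from two coordinates on; in lower
-- dimensions the top is itself the anchor.
price-raised : ∀ n → PartialFunction n
price-raised n x =
  if anchored n x then just (ι (price n x))
  else if isTop x then just (ι (price n x ℚ.+ 1ℚ))
  else nothing

price-raised-values : ∀ n x {r} → price-raised n x ≡ just r →
  (anchored n x ≡ true × ι (price n x) ≡ r) ⊎ (isTop x ≡ true × ι (price n x ℚ.+ 1ℚ) ≡ r)
price-raised-values n x eq with anchored n x | isTop x
price-raised-values n x refl | true  | _    = inj₁ (refl , refl)
price-raised-values n x refl | false | true = inj₂ (refl , refl)

price-raised-not-extendable : ∀ m → ¬ Extendable (price-raised (suc (suc m)))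
price-raised-not-extendable m (G , G-sub , G-ext) =
  ι-gap (G (top n)) (price n (top n)) (anchors-bound-top n G G-sub (λ x x∈ → G-ext x _ (at-anchor x x∈)))
    (≃⇒≥ (G (top n)) (ι (price n (top n) ℚ.+ 1ℚ)) (G-ext (top n) _ at-top))
  where
  n = suc (suc m)
  at-anchor : ∀ x → anchored n x ≡ true → price-raised n x ≡ just (ι (price n x))
  at-anchor x x∈ = cong (λ b → if b then just (ι (price n x))
    else if isTop x then just (ι (price n x ℚ.+ 1ℚ)) else nothing) x∈
  at-top : price-raised n (top n) ≡ just (ι (price n (top n) ℚ.+ 1ℚ))
  at-top = cong (λ b → if b then just (ι (price n (top n) ℚ.+ 1ℚ)) else nothing) (isTop-top m)

-- Strict inclusion only refutes `D ⊆ A`. Exhausting the finite cube turns this into an actual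
-- vertex of the domain outside `A`.
search : ∀ {n} {P : Pred (Cube n) 0ℓ} → Decidable P → (∃[ x ] P x) ⊎ (∀ x → ¬ P x)
search {zero} P? with P? []
... | yes p = inj₁ ([] , p)
... | no ¬p = inj₂ λ { [] → ¬p }
search {suc n} P? with search (P? ∘ (false ∷_)) | search (P? ∘ (true ∷_))
... | inj₁ (x , p) | _            = inj₁ (false ∷ x , p)
... | inj₂ _       | inj₁ (x , p) = inj₁ (true ∷ x , p)
... | inj₂ ¬f      | inj₂ ¬t      = inj₂ λ { (false ∷ x) → ¬f x ; (true ∷ x) → ¬t x }

restrict-just : ∀ {n} (f : PartialFunction n) {A : Pred (Cube n) 0ℓ} (A? : Decidable A) {x r} →
  restrict f A? x ≡ just r → A x × f x ≡ just r
restrict-just f A? {x} eq with A? x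
... | yes a = a , eq

is-just⇒≡ : ∀ {A : Set} {m : Maybe A} → Is-just m → ∃[ a ] m ≡ just a
is-just⇒≡ {m = just a} _ = a , refl

price-raised-minimal : ∀ n (A : Pred (Cube n) 0ℓ) (A? : Decidable A) → A ⊂ D (price-raised n) →
  Extendable (restrict (price-raised n) A?)
price-raised-minimal n A A? (A⊆D , D⊈A)
  with search (λ x → D? (price-raised n) x ×-dec ¬? (A? x))
... | inj₂ none = ⊥-elim (D⊈A λ {x} x∈D → decidable-stable (A? x) (λ x∉A → none x (x∈D , x∉A)))
... | inj₁ (y , y∈D , y∉A) with price-raised-values n y (proj₂ (is-just⇒≡ y∈D))
-- An anchor is missing: its release attains the raised top and keeps every other anchor, and each
-- anchor in `A` differs from `y`.
... | inj₁ (y∈ , _) = ι ∘ relax n y , ι-submodular (relax n y) (relax-submodular n y y∈) , extends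
  where
  extends : (ι ∘ relax n y) Extends restrict (price-raised n) A?
  extends x r eq with restrict-just (price-raised n) A? eq
  ... | x∈A , eq′ with price-raised-values n x eq′
  ... | inj₁ (x∈ , refl) = ι-cong (relax-agrees n x y x∈ y∈ (λ { refl → y∉A x∈A }))
  ... | inj₂ (x-top , refl) with isTop⇒≡top x x-top
  ... | refl = ι-cong (relax-top n y y∈)
-- The top is missing: the tight function itself extends what is left.
... | inj₂ (y-top , _) = ι ∘ price n , ι-submodular (price n) (price-submodular n) , extends
  where
  extends : (ι ∘ price n) Extends restrict (price-raised n) A?
  extends x r eq with restrict-just (price-raised n) A? eq
  ... | x∈A , eq′ with price-raised-values n x eq′
  ... | inj₁ (x∈ , refl) = ι-cong {price n x} refl
  ... | inj₂ (x-top , _) with trans (isTop⇒≡top x x-top) (sym (isTop⇒≡top y y-top))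
  ... | refl = contradiction x∈A y∉A

-- The size of the domain

-- Recursion on coordinates lets the count of a predicate built by `layers` split by computation
-- into its four faces.
count : ∀ n → (Cube n → Bool) → ℕ
count zero    p = if p [] then 1 else 0
count (suc n) p = count n (λ x → p (false ∷ x)) ℕ.+ count n (λ x → p (true ∷ x))

length-filter-map : ∀ {A B : Set} {P : Pred B 0ℓ} (P? : Decidable P) (h : A → B) xs →
  length (filter P? (List.map h xs)) ≡ length (filter (P? ∘ h) xs)
length-filter-map P? h List.[] = refl
length-filter-map P? h (x List.∷ xs) with does (P? (h x))
... | true  = cong suc (length-filter-map P? h xs)
... | false = length-filter-map P? h xs

length-filter-vertices : ∀ n {P : Pred (Cube n) 0ℓ} (P? : Decidable P) →
  length (filter P? (vertices n)) ≡ count n (does ∘ P?)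
length-filter-vertices zero P? with does (P? [])
... | true  = refl
... | false = refl
length-filter-vertices (suc n) P? = trans
  (cong length (filter-++ P? (List.map (false ∷_) (vertices n)) (List.map (true ∷_) (vertices n))))
  (trans (length-++ (filter P? (List.map (false ∷_) (vertices n))))
    (cong₂ ℕ._+_ (half false) (half true)))
  where
  half : ∀ b → length (filter P? (List.map (b ∷_) (vertices n))) ≡ count n (λ x → does (P? (b ∷ x)))
  half b = trans (length-filter-map P? (b ∷_) (vertices n)) (length-filter-vertices n (P? ∘ (b ∷_)))

count-cong : ∀ n {p q : Cube n → Bool} → (∀ x → p x ≡ q x) → count n p ≡ count n q
count-cong zero    eq rewrite eq [] = refl
count-cong (suc n) eq = cong₂ ℕ._+_ (count-cong n (eq ∘ (false ∷_))) (count-cong n (eq ∘ (true ∷_)))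

count-none : ∀ n → count n (const false) ≡ 0
count-none zero    = refl
count-none (suc n) = cong₂ ℕ._+_ (count-none n) (count-none n)

count-isTop : ∀ n → count n isTop ≡ 1
count-isTop zero    = refl
count-isTop (suc n) = cong₂ ℕ._+_ (count-none n) (count-isTop n)

-- Two more coordinates turn `e` anchors into `1 + 2e`, so `1 + e` doubles and its square keeps pace
-- with the factor 4 in `2 ^ n`.
count-anchored : ∀ n → 2 ^ n ≤ (1 ℕ.+ count n (anchored n)) ^ 2
count-anchored zero       = s≤s z≤n
count-anchored (suc zero) = s≤s (s≤s z≤n)
count-anchored (suc (suc n)) rewrite count-isTop n | count-none n = begin
  2 * (2 * 2 ^ n)                       ≤⟨ ℕ.*-monoʳ-≤ 2 (ℕ.*-monoʳ-≤ 2 (count-anchored n)) ⟩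
  2 * (2 * (1 ℕ.+ e) ^ 2)               ≡⟨ double-square e ⟩
  (1 ℕ.+ (1 ℕ.+ e ℕ.+ (e ℕ.+ 0))) ^ 2   ∎
  where
  open ℕ.≤-Reasoning
  e = count n (anchored n)

count-∨ : ∀ n {p q : Cube n → Bool} → (∀ x → p x ≡ true → q x ≡ false) →
  count n (λ x → p x ∨ q x) ≡ count n p ℕ.+ count n q
count-∨ zero {p} {q} disjoint with p [] | q [] | disjoint []
... | true  | true  | d = contradiction (d refl) λ ()
... | true  | false | _ = refl
... | false | _     | _ = refl
count-∨ (suc n) {p} {q} disjoint = trans
  (cong₂ ℕ._+_ (count-∨ n (disjoint ∘ (false ∷_))) (count-∨ n (disjoint ∘ (true ∷_))))
  (interchange (count n (p ∘ (false ∷_))) (count n (q ∘ (false ∷_)))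
    (count n (p ∘ (true ∷_))) (count n (q ∘ (true ∷_))))
  where open CommutativeSemigroupProperties ℕ.+-commutativeSemigroup using (interchange)

does-D? : ∀ n x → does (D? (price-raised n) x) ≡ isTop x ∨ anchored n x
does-D? n x with isTop x | anchored n x
... | true  | true  = refl
... | true  | false = refl
... | false | true  = refl
... | false | false = refl

top-not-anchored : ∀ m x → isTop x ≡ true → anchored (suc (suc m)) x ≡ false
top-not-anchored m (true ∷ true ∷ x) _ = refl

∣D∣-price-raised : ∀ m → let n = suc (suc m) in ∣D price-raised n ∣ ≡ 1 ℕ.+ count n (anchored n)
∣D∣-price-raised m =
  trans (length-filter-vertices n (D? (price-raised n)))
  (trans (count-cong n (does-D? n))
  (trans (count-∨ n (top-not-anchored m))
  (cong (ℕ._+ count n (anchored n)) (count-isTop n))))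
  where n = suc (suc m)

theorem2 : Σ[ c ∈ ℚ ] (0ℚ < c × (Σ[ N ∈ ℕ ] (∀ (n : ℕ) → N ≤ n →
    Σ[ f ∈ PartialFunction n ] (MinimallyNonExtendable f × 2 ^ (∣ ↥ c ∣ * n) ≤ ∣D f ∣ ^ (↧ₙ c)))))
-- Two coordinates per doubling give the exponent ½, so the size bound reads `2 ^ n ≤ d ^ 2` for a
-- domain of size `d`. The threshold 2 is where the top stops being an anchor.
theorem2 = ½ , 0<½ , 2 , λ { (suc zero) (s≤s ()) ; (suc (suc m)) _ → let n = suc (suc m) in
  price-raised n ,
  (price-raised-not-extendable m , price-raised-minimal n) ,
  subst₂ (λ k d → 2 ^ k ≤ d ^ 2) (sym (ℕ.*-identityˡ n)) (sym (∣D∣-price-raised m)) (count-anchored n) }
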